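{- Let $u$ be a parking sorted configuration on $K_{m,n}$ with $u_{a_m}\ge 0$, and let $r(u)=(r_1,\dots,r_n)$ be its $r$-vector. Write $u_{a_m}+1=nQ+R$ with $Q,R\in\mathbb N$ and $0\le R<n$. Then $$\mathrm{rank}(u)+1=\sum_{i=1}^n\max\{0,\;Q+\chi(i\le R)+r_i-1\},$$ where $\chi(\mathcal P)=1$ if the proposition $\mathcal P$ is true and $0$ otherwise.
   Context: Let $m,n\ge 1$. $K_{m,n}$ is the complete bipartite graph with vertex set $V=A_m\sqcup B_n$, $A_m=\{a_1,\dots,a_m\}$, $B_n=\{b_1,\dots,b_n\}$, with exactly one edge $\{a_i,b_j\}$ for every $i,j$; $a_m$ is the sink. A configuration is a function $u:V\to\mathbb Z$; $\mathrm{degree}(u)=\sum_c u_c$. For $c\in V$ with graph degree $d_c$ ($d_{a_i}=n$, $d_{b_j}=m$), $\Delta^{(c)}=d_c e_c-\sum_{c'\text{ adjacent to }c}e_{c'}$, with $e_c$ the indicator configuration of $c$; $\Delta^{(C)}=\sum_{c\in C}\Delta^{(c)}$. Toppling equivalence: difference is an integer combination of the $\Delta^{(c)}$. Effective: toppling equivalent to a non-negative configuration. $\mathrm{rank}(u)=-1+\min\{\mathrm{degree}(f): f\ge0,\ u-f\text{ not effective}\}$. A configuration $u$ is parking if $u_c\ge0$ for all $c\neq a_m$ and for every non-empty $C\subseteq V\setminus\{a_m\}$, $u-\Delta^{(C)}$ has a negative value at some vertex other than $a_m$. $u$ is sorted if $u_{a_1}\le\dots\le u_{a_{m-1}}$ and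 $u_{b_1}\le\dots\le u_{b_n}$ (no condition at the sink). For a configuration $u$ with $0\le u_{a_j}\le n-1$ ($j<m$) and $0\le u_{b_i}\le m-1$ that is sorted (in particular any parking sorted configuration), its $r$-vector is $r(u)=(r_1,\dots,r_n)$ with $r_i=u_{b_i}+1-\#\{j\in\{1,\dots,m-1\}: u_{a_j}+1\le i-1\}$; it does not depend on $u_{a_m}$. -}

module Defs where

open import Data.Bool.Base using (Bool; true; if_then_else_)
open import Data.Empty using (⊥)
open import Data.Fin.Base as Fin using (Fin; toℕ; fromℕ; inject₁)
import Data.Fin.Properties as Fin
open import Data.Integer.Base
  using (ℤ; +_; 0ℤ; 1ℤ; -1ℤ; _+_; _-_; _*_; _≤_; _<_)
open import Data.Integer.Properties using (_≤?_; +-0-commutativeMonoid)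
open import Data.Nat.Base using (ℕ; suc)
open import Data.Product.Base using (Σ; ∃; ∃-syntax; _×_; _,_)
open import Data.Sum.Base using (_⊎_; inj₁; inj₂)
open import Data.Sum.Properties using (≡-dec)
open import Data.Unit.Base using (⊤; tt)
open import Relation.Binary.Definitions using (DecidableEquality)
open import Relation.Binary.PropositionalEquality.Core using (_≡_; _≢_)
open import Relation.Nullary.Decidable.Core using (Dec; yes; no; does)
open import Relation.Nullary.Negation.Core using (¬_)

open import Algebra.Properties.CommutativeMonoid.Sum +-0-commutativeMonoid public
  using (sum-syntax)

χ : {P : Set} → Dec P → ℤ
χ P? = if does P? then 1ℤ else 0ℤ

-- inj₁ i and inj₂ j are the vertices a_{i+1} and b_{j+1} of K_{m,n}:
-- indices start from 0 here.
V : ℕ → ℕ → Set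
V m n = Fin m ⊎ Fin n

_≟_ : ∀ {m n} → DecidableEquality (V m n)
_≟_ = ≡-dec Fin._≟_ Fin._≟_

Adjacent : ∀ {m n} → V m n → V m n → Set
Adjacent (inj₁ _) (inj₁ _) = ⊥
Adjacent (inj₁ _) (inj₂ _) = ⊤
Adjacent (inj₂ _) (inj₁ _) = ⊤
Adjacent (inj₂ _) (inj₂ _) = ⊥

adjacent? : ∀ {m n} (c d : V m n) → Dec (Adjacent c d)
adjacent? (inj₁ _) (inj₁ _) = no λ ()
adjacent? (inj₁ _) (inj₂ _) = yes tt
adjacent? (inj₂ _) (inj₁ _) = yes tt
adjacent? (inj₂ _) (inj₂ _) = no λ ()

graphDegree : ∀ {m n} → V m n → ℤ
graphDegree {m} {n} (inj₁ _) = + n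
graphDegree {m} {n} (inj₂ _) = + m

-- The last vertex a_m; this is where m ≥ 1 is needed.
sink : ∀ {m n} → V (suc m) n
sink {m} = inj₁ (fromℕ m)

Config : ℕ → ℕ → Set
Config m n = V m n → ℤ

∑V : ∀ {m n} → (V m n → ℤ) → ℤ
∑V {m} {n} f = (∑[ i < m ] f (inj₁ i)) + (∑[ j < n ] f (inj₂ j))

infixl 6 _⊖_
_⊖_ : ∀ {m n} → Config m n → Config m n → Config m n
(u ⊖ v) x = u x - v x

degree : ∀ {m n} → Config m n → ℤ
degree = ∑V

NonNegative : ∀ {m n} → Config m n → Set
NonNegative u = ∀ c → 0ℤ ≤ u c

e : ∀ {m n} → V m n → Config m n
e c x = χ (c ≟ x)

Δ : ∀ {m n} → V m n → Config m n
Δ c x = graphDegree c * e c x - ∑V (λ c′ → χ (adjacent? c c′) * e c′ x)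

-- Subsets of the finite set V are given by their characteristic functions.
ΔSet : ∀ {m n} → (V m n → Bool) → Config m n
ΔSet C x = ∑V (λ c → if C c then Δ c x else 0ℤ)

ToppleEquivalent : ∀ {m n} → Config m n → Config m n → Set
ToppleEquivalent {m} {n} u v =
  Σ (V m n → ℤ) λ k → ∀ x → u x - v x ≡ ∑V (λ c → k c * Δ c x)

Effective : ∀ {m n} → Config m n → Set
Effective u = ∃[ v ] NonNegative v × ToppleEquivalent u v

IsMinimum : (ℤ → Set) → ℤ → Set
IsMinimum P d = P d × (∀ d′ → P d′ → d ≤ d′)

-- Minima of undecided sets of integers cannot be computed in general, so
-- the rank is given by its graph: IsRank u ρ says that the minimum defining
-- rank(u) exists and that rank(u) = ρ.
IsRank : ∀ {m n} → Config m n → ℤ → Set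
IsRank {m} {n} u ρ =
  ∃[ d ] IsMinimum
           (λ k → Σ (Config m n) λ f →
              NonNegative f × ¬ Effective (u ⊖ f) × degree f ≡ k)
           d
       × ρ ≡ -1ℤ + d

Parking : ∀ {m n} → Config (suc m) n → Set
Parking {m} {n} u =
    (∀ c → c ≢ sink → 0ℤ ≤ u c)
  × ((C : V (suc m) n → Bool) →
       (∃[ c ] C c ≡ true) →
       (∀ c → C c ≡ true → c ≢ sink) →
       ∃[ c ] c ≢ sink × (u ⊖ ΔSet C) c < 0ℤ)

-- inject₁ enumerates a_1, …, a_{m-1}, leaving out the sink.
Sorted : ∀ {m n} → Config (suc m) n → Set
Sorted {m} {n} u =
    (∀ (i j : Fin m) → i Fin.≤ j → u (inj₁ (inject₁ i)) ≤ u (inj₁ (inject₁ j)))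
  × (∀ (i j : Fin n) → i Fin.≤ j → u (inj₂ i) ≤ u (inj₂ j))

-- With indices from 0, the bound i - 1 of the usual formula becomes toℕ i.
r : ∀ {m n} → Config (suc m) n → Fin n → ℤ
r {m} u i =
  u (inj₂ i) + 1ℤ - (∑[ j < m ] χ (u (inj₁ (inject₁ j)) + 1ℤ ≤? + toℕ i))

{-# OPTIONS --safe #-}

-- Write z_w(t) = Σ_j ⌈(t - w_{b_j})/m⌉ and y_w(s) = Σ_i ⌈(s - w_{a_i})/n⌉. A
-- configuration w is effective iff z_w(y_w(s)) ≤ s for some integer s.
-- By Hermite's identity, lowering w on the b's by a total of D raises the sum
-- of z_w over a period by D (similarly for y_w on the a's), so rank(u) + 1 is
-- the least area by which z and y have to be raised until z(y(s)) > s for all s.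
-- If only the b's are lowered, the cheapest way replaces u_{b_i} by its minimum
-- with y_u(i-1) - 1 for i = 1, …, n: these minima extend to a weakly increasing
-- quasi-periodic sequence on ℤ, whose counting function z is the least possible.
-- Lowering the a's by D increases Σ_{i=1}^n y(i-1) by D, hence saves at most D
-- on the b's. Finally, for sorted parking u,
-- u_{b_i} + 1 - y_u(i-1) = Q + χ(i ≤ R) + r_i - 1.

module Submission where

open import Defs
open import Data.Fin.Base using (toℕ)
open import Data.Integer.Base using (ℤ; +_; 0ℤ; 1ℤ; _+_; _-_; _*_; _≤_; _⊔_)
open import Data.Nat.Base as ℕ using (ℕ; suc)
open import Data.Nat.Properties as ℕ using ()
open import Data.Product.Base using (∃-syntax; _×_)
open import Relation.Binary.PropositionalEquality.Core using (_≡_)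

import Data.Integer.Properties as ℤ
open import Algebra.Properties.CommutativeMonoid.Sum ℤ.+-0-commutativeMonoid
  using (sum; sum-cong-≗; ∑-distrib-+; ∑-comm; sum-init-last)
open import Data.Bool.Base using (true; false; if_then_else_)
open import Data.Fin.Base as Fin using (Fin; zero; suc; inject₁; fromℕ<)
import Data.Fin.Properties as Fin
open import Data.Fin.Properties using (toℕ<n; toℕ-fromℕ<)
open import Data.Integer.Base
  using (-[1+_]; +≤+; +<+; -_; -1ℤ; _<_; _⊓_; _/ℕ_; _%ℕ_)
open import Data.Integer.DivMod
  using ([n/ℕd]*d≤n; n<s[n/ℕd]*d; a≡a%ℕn+[a/ℕn]*n; n%ℕd<d)
open import Data.Integer.Tactic.RingSolver using (solve-∀)
open import Data.Product.Base using (_,_; proj₁; proj₂)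
open import Data.Sum.Base using (inj₁; inj₂)
open import Data.Sum.Properties using (inj₁-injective)
open import Function.Base using (_∘_)
open import Relation.Binary.PropositionalEquality
  using (_≢_; refl; sym; trans; cong; cong₂; subst)
open import Relation.Nullary.Decidable using (Dec; yes; no; does; dec-true; dec-false)
open import Relation.Nullary.Negation.Core using (¬_; contradiction)

-- Linear arithmetic

-- Linear inequalities are proved by adding up known ones and letting the ring solver check that the
-- gap obtained equals the gap of the goal.
≤-via : ∀ {a b c d} → a ≤ b → b - a ≡ d - c → c ≤ d
≤-via a≤b eq = ℤ.0≤i-j⇒j≤i (subst (0ℤ ≤_) eq (ℤ.i≤j⇒0≤j-i a≤b))

<-via : ∀ {a b c d} → a < b → b - a ≡ d - c → c < d
<-via {a} {b} {c} {d} a<b eq =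
  ℤ.suc[i]≤j⇒i<j (≤-via (ℤ.i<j⇒suc[i]≤j a<b)
    (trans (suc-diff a b) (trans (cong (_- 1ℤ) eq) (sym (suc-diff c d)))))
  where
  suc-diff : ∀ x y → y - (1ℤ + x) ≡ y - x - 1ℤ
  suc-diff = solve-∀

<⇒1+≤ : ∀ {a b} → a < b → 1ℤ + a ≤ b
<⇒1+≤ = ℤ.i<j⇒suc[i]≤j

-1<⇒≤ : ∀ {a b} → a - 1ℤ < b → a ≤ b
-1<⇒≤ {a} {b} a-1<b = ≤-via (<⇒1+≤ a-1<b) (eq a b)
  where
  eq : ∀ x y → y - (1ℤ + (x - 1ℤ)) ≡ y - x
  eq = solve-∀

x-1<x : ∀ x → x - 1ℤ < x
x-1<x x = <-via (+<+ (ℕ.n<1+n 0)) (eq x)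
  where
  eq : ∀ x → 1ℤ - 0ℤ ≡ x - (x - 1ℤ)
  eq = solve-∀

-- Finite sums of integers

sum-mono-≤ : ∀ {n} {f g : Fin n → ℤ} → (∀ i → f i ≤ g i) → sum f ≤ sum g
sum-mono-≤ {ℕ.zero} f≤g = ℤ.≤-refl
sum-mono-≤ {suc n}  f≤g = ℤ.+-mono-≤ (f≤g zero) (sum-mono-≤ (f≤g ∘ suc))

sum-const : ∀ n t → ∑[ i < n ] t ≡ t * + n
sum-const ℕ.zero  t = sym (ℤ.*-zeroʳ t)
sum-const (suc n) t = trans (cong (_+_ t) (sum-const n t)) (eq t (+ n))
  where
  eq : ∀ x y → x + x * y ≡ x * (1ℤ + y)
  eq = solve-∀

∑-distrib-- : ∀ {n} (f g : Fin n → ℤ) → ∑[ i < n ] (f i - g i) ≡ sum f - sum g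
∑-distrib-- {ℕ.zero} f g = refl
∑-distrib-- {suc n}  f g =
  trans (cong (_+_ (f zero - g zero)) (∑-distrib-- (f ∘ suc) (g ∘ suc)))
        (eq (f zero) (g zero) _ _)
  where
  eq : ∀ a b c d → a - b + (c - d) ≡ a + c - (b + d)
  eq = solve-∀

sum-zero : ∀ n → ∑[ i < n ] 0ℤ ≡ 0ℤ
sum-zero n = sum-const n 0ℤ

sum-neg : ∀ {n} (f : Fin n → ℤ) → ∑[ i < n ] (- f i) ≡ - sum f
sum-neg {n} f =
  trans (sum-cong-≗ (λ i → sym (ℤ.+-identityˡ (- f i))))
        (trans (∑-distrib-- (λ _ → 0ℤ) f)
               (trans (cong (_- sum f) (sum-zero n)) (ℤ.+-identityˡ (- sum f))))

sum-nonNeg : ∀ {n} {f : Fin n → ℤ} → (∀ i → 0ℤ ≤ f i) → 0ℤ ≤ sum f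
sum-nonNeg {n} {f} 0≤f = subst (_≤ sum f) (sum-zero n) (sum-mono-≤ 0≤f)

sum-χ : ∀ {n} (f : Fin n → ℤ) i → ∑[ j < n ] (f j * χ (j Fin.≟ i)) ≡ f i
sum-χ {suc n} f zero =
  trans (cong₂ _+_ (ℤ.*-identityʳ (f zero))
               (trans (sum-cong-≗ (λ j → ℤ.*-zeroʳ (f (suc j)))) (sum-zero n)))
        (ℤ.+-identityʳ (f zero))
sum-χ {suc n} f (suc i) =
  trans (cong₂ _+_ (ℤ.*-zeroʳ (f zero)) (sum-χ (f ∘ suc) i))
        (ℤ.+-identityˡ (f (suc i)))

-- Both sides are `g 0 + … + g n`, with the first or the last term set apart.
sum-shift : ∀ n (g : ℕ → ℤ) →
  ∑[ i < n ] g (suc (toℕ i)) + g 0 ≡ ∑[ i < n ] g (toℕ i) + g n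
sum-shift ℕ.zero  g = refl
sum-shift (suc n) g =
  trans (cong (_+ g 0) (trans (ℤ.+-comm (g 1) _) (sum-shift n (g ∘ suc))))
        (eq _ (g (suc n)) (g 0))
  where
  eq : ∀ a b c → a + b + c ≡ c + a + b
  eq = solve-∀

-- A weakly decreasing integer vector whose entries differ by at most one is
-- (τ+1, …, τ+1, τ, …, τ), so it is determined by its sum; the next two lemmas
-- compare an entry with the quotient of the sum by the length.

sum-lower : ∀ {n} (c : Fin n → ℤ) (σ : Fin n) τ →
  (∀ i → i Fin.≤ σ → τ < c i) → (∀ i → τ ≤ c i) →
  τ * + n + + toℕ σ < sum c
sum-lower {suc n} c zero τ big all =
  <-via (ℤ.+-mono-<-≤ (big zero ℕ.z≤n)
          (subst (_≤ sum (c ∘ suc)) (sum-const n τ) (sum-mono-≤ (all ∘ suc))))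
        (eq (sum c) τ (+ n))
  where
  eq : ∀ S x y → S - (x + x * y) ≡ S - (x * (1ℤ + y) + 0ℤ)
  eq = solve-∀
sum-lower {suc n} c (suc σ) τ big all =
  <-via (ℤ.+-mono-≤-< (<⇒1+≤ (big zero ℕ.z≤n))
          (sum-lower (c ∘ suc) σ τ (λ i i≤σ → big (suc i) (ℕ.s≤s i≤σ)) (all ∘ suc)))
        (eq (sum c) τ (+ n) (+ toℕ σ))
  where
  eq : ∀ S x y z → S - (1ℤ + x + (x * y + z)) ≡ S - (x * (1ℤ + y) + (1ℤ + z))
  eq = solve-∀

sum-upper : ∀ {n} (c : Fin n → ℤ) (σ : Fin n) τ →
  (∀ i → σ Fin.≤ i → c i ≤ τ) → (∀ i → c i ≤ 1ℤ + τ) →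
  sum c ≤ τ * + n + + toℕ σ
sum-upper {suc n} c zero τ small all =
  subst (sum c ≤_) (trans (sum-const (suc n) τ) (sym (ℤ.+-identityʳ _)))
    (sum-mono-≤ (λ i → small i ℕ.z≤n))
sum-upper {suc n} c (suc σ) τ small all =
  ≤-via (ℤ.+-mono-≤ (all zero)
          (sum-upper (c ∘ suc) σ τ (λ i σ≤i → small (suc i) (ℕ.s≤s σ≤i)) (all ∘ suc)))
        (eq (sum c) τ (+ n) (+ toℕ σ))
  where
  eq : ∀ S x y z → 1ℤ + x + (x * y + z) - S ≡ x * (1ℤ + y) + (1ℤ + z) - S
  eq = solve-∀

divMod : ∀ n s → ∃[ τ ] ∃[ σ ] s ≡ τ * + suc n + + toℕ {suc n} σ
divMod n s = s /ℕ suc n , fromℕ< r<n ,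
  trans (a≡a%ℕn+[a/ℕn]*n s (suc n))
        (trans (ℤ.+-comm (+ (s %ℕ suc n)) (s /ℕ suc n * + suc n))
               (cong (λ t → s /ℕ suc n * + suc n + + t) (sym (toℕ-fromℕ< r<n))))
  where
  r<n = n%ℕd<d s (suc n)

-- Integer division rounding up

⌈_/_⌉ : ℤ → (d : ℕ) .{{_ : ℕ.NonZero d}} → ℤ
⌈ x / d ⌉ = - (- x /ℕ d)

module _ (d : ℕ) .{{_ : ℕ.NonZero d}} where

  x≤⌈x/d⌉*d : ∀ x → x ≤ ⌈ x / d ⌉ * + d
  x≤⌈x/d⌉*d x = ≤-via ([n/ℕd]*d≤n (- x) d) (eq x (- x /ℕ d) (+ d))
    where
    eq : ∀ x q d → - x - q * d ≡ - q * d - x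
    eq = solve-∀

  -- Together with `x≤⌈x/d⌉*d` this is the adjunction between rounding up and multiplication by `d`;
  -- the further facts about ceilings rest on these two.
  ⌈/⌉-least : ∀ {x k} → x ≤ k * + d → ⌈ x / d ⌉ ≤ k
  ⌈/⌉-least {x} {k} x≤kd = ≤-via (<⇒1+≤ -k<1+q) (eq k (- x /ℕ d))
    where
    eq : ∀ k q → 1ℤ + q - (1ℤ + - k) ≡ k - - q
    eq = solve-∀
    -k<1+q : - k < 1ℤ + (- x /ℕ d)
    -k<1+q = ℤ.*-cancelʳ-<-nonNeg (+ d)
      (ℤ.≤-<-trans (subst (_≤ - x) (ℤ.neg-distribˡ-* k (+ d)) (ℤ.neg-mono-≤ x≤kd))
                   (n<s[n/ℕd]*d (- x) d))

  *<⇒<⌈/⌉ : ∀ {x k} → k * + d < x → k < ⌈ x / d ⌉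
  *<⇒<⌈/⌉ {x} kd<x = ℤ.*-cancelʳ-<-nonNeg (+ d) (ℤ.<-≤-trans kd<x (x≤⌈x/d⌉*d x))

  ⌈/⌉-mono-≤ : ∀ {x y} → x ≤ y → ⌈ x / d ⌉ ≤ ⌈ y / d ⌉
  ⌈/⌉-mono-≤ {x} {y} x≤y = ⌈/⌉-least (ℤ.≤-trans x≤y (x≤⌈x/d⌉*d y))

  ⌈/⌉-unique : ∀ {x k} → (k - 1ℤ) * + d < x → x ≤ k * + d → ⌈ x / d ⌉ ≡ k
  ⌈/⌉-unique lo hi = ℤ.≤-antisym (⌈/⌉-least hi) (-1<⇒≤ (*<⇒<⌈/⌉ lo))

  ⌈/⌉-shift : ∀ x t → ⌈ (x + t * + d) / d ⌉ ≡ ⌈ x / d ⌉ + t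
  ⌈/⌉-shift x t = ℤ.≤-antisym
    (⌈/⌉-least (≤-via (x≤⌈x/d⌉*d x) (eq₁ x t (+ d) ⌈ x / d ⌉)))
    (≤-via (⌈/⌉-least {k = c - t} (≤-via (x≤⌈x/d⌉*d (x + t * + d)) (eq₂ x t (+ d) c)))
           (eq₃ c t ⌈ x / d ⌉))
    where
    c = ⌈ (x + t * + d) / d ⌉
    eq₁ : ∀ x t d c → c * d - x ≡ (c + t) * d - (x + t * d)
    eq₁ = solve-∀
    eq₂ : ∀ x t d c → c * d - (x + t * d) ≡ (c - t) * d - x
    eq₂ = solve-∀
    eq₃ : ∀ c t b → c - t - b ≡ c - (b + t)
    eq₃ = solve-∀

-- count d v h is the signed number of pairs (j , t) with v j + t * d < h,
-- those with t ≥ 0 counting positively and those missing with t < 0 negatively.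

count : ∀ {n} (d : ℕ) .{{_ : ℕ.NonZero d}} → (Fin n → ℤ) → ℤ → ℤ
count {n} d v h = ∑[ j < n ] ⌈ (h - v j) / d ⌉

-- Hermite's identity and sums of counting functions over a period

ceilSum : (d : ℕ) .{{_ : ℕ.NonZero d}} → ℤ → ℤ
ceilSum d w = ∑[ h < d ] ⌈ (+ toℕ h - w) / d ⌉

constant-ℤ : (f : ℤ → ℤ) → (∀ w → f (1ℤ + w) ≡ f w) → ∀ w → f w ≡ f 0ℤ
constant-ℤ f step (+ ℕ.zero)     = refl
constant-ℤ f step (+ suc n)      = trans (step (+ n)) (constant-ℤ f step (+ n))
constant-ℤ f step -[1+ ℕ.zero ]  = sym (step -1ℤ)
constant-ℤ f step -[1+ suc n ]   =
  trans (sym (step -[1+ suc n ])) (constant-ℤ f step -[1+ n ])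

module _ (d : ℕ) .{{_ : ℕ.NonZero d}} where

  count-monoʳ : ∀ {n} (v : Fin n → ℤ) {h h′} → h ≤ h′ → count d v h ≤ count d v h′
  count-monoʳ v h≤h′ =
    sum-mono-≤ (λ j → ⌈/⌉-mono-≤ d (ℤ.+-monoˡ-≤ (- v j) h≤h′))

  count-anti-v : ∀ {n} {v w : Fin n → ℤ} h →
    (∀ j → w j ≤ v j) → count d v h ≤ count d w h
  count-anti-v h w≤v =
    sum-mono-≤ (λ j → ⌈/⌉-mono-≤ d (ℤ.+-monoʳ-≤ h (ℤ.neg-mono-≤ (w≤v j))))

  count-shift : ∀ {n} (v : Fin n → ℤ) h t →
    count d v (h + t * + d) ≡ count d v h + t * + n
  count-shift {n} v h t =
    trans (sum-cong-≗ λ j →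
             trans (cong (λ x → ⌈ x / d ⌉) (eq h (t * + d) (v j)))
                   (⌈/⌉-shift d (h - v j) t))
          (trans (∑-distrib-+ (λ j → ⌈ (h - v j) / d ⌉) (λ _ → t))
                 (cong (_+_ (count d v h)) (sum-const n t)))
    where
    eq : ∀ a b c → a + b - c ≡ a - c + b
    eq = solve-∀

  -- Raising `w` by one moves the window of `d` consecutive numerators down by one: the top
  -- numerator is replaced by the one `d` lower, whose ceiling is smaller by exactly one.
  ceilSum-step : ∀ w → ceilSum d (1ℤ + w) + (1ℤ + w) ≡ ceilSum d w + w
  ceilSum-step w = trans (eq₁ (ceilSum d (1ℤ + w)) w (g 0)) (trans
    (cong (λ z → z + w - g 0) (trans (cong (_+_ (ceilSum d (1ℤ + w))) (sym g-d))
                                      (sym (sum-shift d g))))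
    (trans (eq₂ (∑[ h < d ] g (suc (toℕ h))) (g 0) w) (cong (_+ w) (sum-cong-≗ {d} λ h →
      cong (λ x → ⌈ x / d ⌉) (eq₃ (+ toℕ h) w)))))
    where
    g : ℕ → ℤ
    g h = ⌈ (+ h - (1ℤ + w)) / d ⌉
    eq₀ : ∀ d w → d - (1ℤ + w) ≡ 0ℤ - (1ℤ + w) + 1ℤ * d
    eq₀ = solve-∀
    g-d : g d ≡ g 0 + 1ℤ
    g-d = trans (cong (λ x → ⌈ x / d ⌉) (eq₀ (+ d) w)) (⌈/⌉-shift d (0ℤ - (1ℤ + w)) 1ℤ)
    eq₁ : ∀ S w g → S + (1ℤ + w) ≡ S + (g + 1ℤ) + w - g
    eq₁ = solve-∀
    eq₂ : ∀ S g w → S + g + w - g ≡ S + w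
    eq₂ = solve-∀
    eq₃ : ∀ h w → 1ℤ + h - (1ℤ + w) ≡ h - w
    eq₃ = solve-∀

  -- Hermite's identity, without computing ceilSum d 0ℤ.
  ceilSum-value : ∀ w → ceilSum d w ≡ ceilSum d 0ℤ - w
  ceilSum-value w =
    trans (eq (ceilSum d w) w)
          (cong (_- w) (trans (constant-ℤ (λ z → ceilSum d z + z) ceilSum-step w)
                              (ℤ.+-identityʳ (ceilSum d 0ℤ))))
    where
    eq : ∀ S w → S ≡ S + w - w
    eq = solve-∀

  sum-count : ∀ {n} (v : Fin n → ℤ) →
    ∑[ h < d ] count d v (+ toℕ h) ≡ ceilSum d 0ℤ * + n - sum v
  sum-count {n} v =
    trans (∑-comm {d} {n} (λ h j → ⌈ (+ toℕ h - v j) / d ⌉))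
    (trans (sum-cong-≗ (λ j → ceilSum-value (v j)))
    (trans (∑-distrib-- (λ _ → ceilSum d 0ℤ) v)
           (cong (_- sum v) (sum-const n (ceilSum d 0ℤ)))))

  -- The constant of Hermite's identity cancels, so a change in the total of the entries becomes an
  -- area between counting functions.
  sum-count-diff : ∀ {n} (v w : Fin n → ℤ) →
    ∑[ h < d ] count d w (+ toℕ h) - ∑[ h < d ] count d v (+ toℕ h) ≡ sum v - sum w
  sum-count-diff {n} v w =
    trans (cong₂ _-_ (sum-count w) (sum-count v))
          (eq (ceilSum d 0ℤ * + n) (sum v) (sum w))
    where
    eq : ∀ c v w → c - w - (c - v) ≡ v - w
    eq = solve-∀

-- These are the conditions under which v extends to a weakly increasing
-- sequence on ℤ with v (j + n) = v j + d.
Staircase : ∀ {n} → ℕ → (Fin n → ℤ) → Set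
Staircase d v = (∀ i j → i Fin.≤ j → v i ≤ v j) × (∀ i j → v i ≤ v j + + d)

staircase-⊓ : ∀ {n d} {v w : Fin n → ℤ} →
  Staircase d v → Staircase d w → Staircase d (λ i → v i ⊓ w i)
staircase-⊓ {d = d} {v} {w} (v-mono , v-wide) (w-mono , w-wide) =
  (λ i j i≤j → ℤ.⊓-mono-≤ (v-mono i j i≤j) (w-mono i j i≤j)) ,
  (λ i j → subst (v i ⊓ w i ≤_) (sym (ℤ.mono-≤-distrib-⊓ (ℤ.+-monoˡ-≤ (+ d)) (v j) (w j)))
                 (ℤ.⊓-mono-≤ (v-wide i j) (w-wide i j)))

-- For the sequence on ℤ extending v, the next two lemmas say that the entry of
-- index τ * n + σ lies below h exactly when that index is less than count d v h.
module _ {n : ℕ} (d : ℕ) .{{_ : ℕ.NonZero d}} {v : Fin n → ℤ} (stair : Staircase d v) where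

  private
    v-mono = proj₁ stair
    v-wide = proj₂ stair

  below⇒index< : ∀ σ τ h → v σ + τ * + d < h → τ * + n + + toℕ σ < count d v h
  below⇒index< σ τ h below = sum-lower (λ i → ⌈ (h - v i) / d ⌉) σ τ
    (λ i i≤σ → *<⇒<⌈/⌉ d {h - v i} (<-via (ℤ.+-mono-≤-< (v-mono i σ i≤σ) below)
      (eq₁ (v i) (v σ) (τ * + d) h)))
    (λ i → -1<⇒≤ (*<⇒<⌈/⌉ d {h - v i} (<-via (ℤ.+-mono-≤-< (v-wide i σ) below)
      (eq₂ (v i) (v σ) τ (+ d) h))))
    where
    eq₁ : ∀ x y t h → y + h - (x + (y + t)) ≡ h - x - t
    eq₁ = solve-∀
    eq₂ : ∀ x y t d h → y + d + h - (x + (y + t * d)) ≡ h - x - (t - 1ℤ) * d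
    eq₂ = solve-∀

  index<⇒below : ∀ σ τ h → τ * + n + + toℕ σ < count d v h → v σ + τ * + d < h
  index<⇒below σ τ h lt = ℤ.≰⇒> λ above → ℤ.≤⇒≯ (sum-upper (λ i → ⌈ (h - v i) / d ⌉) σ τ
    (λ i σ≤i → ⌈/⌉-least d (≤-via (ℤ.+-mono-≤ above (v-mono σ i σ≤i))
      (eq₁ (v i) (v σ) (τ * + d) h)))
    (λ i → ⌈/⌉-least d (≤-via (ℤ.+-mono-≤ above (v-wide σ i))
      (eq₂ (v i) (v σ) τ (+ d) h)))) lt
    where
    eq₁ : ∀ x y t h → y + t + x - (h + y) ≡ t - (h - x)
    eq₁ = solve-∀
    eq₂ : ∀ x y t d h → y + t * d + (x + d) - (h + y) ≡ (1ℤ + t) * d - (h - x)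
    eq₂ = solve-∀

-- Cheapest lowering whose counting function dominates a quasi-periodic sequence

module QuasiPeriodic (m n : ℕ) (Y : ℤ → ℤ)
  (Y-mono : ∀ {s s′} → s ≤ s′ → Y s ≤ Y s′)
  (Y-shift : ∀ s t → Y (s + t * + suc n) ≡ Y s + t * + suc m)
  (u : Fin (suc n) → ℤ) (u-stair : Staircase (suc m) u)
  where

  -- `count` uses a strict inequality, so the entry of index `s` has to be at most `Y s - 1ℤ` to be
  -- counted below `Y s`.
  meet : Fin (suc n) → ℤ
  meet σ = u σ ⊓ (Y (+ toℕ σ) - 1ℤ)

  Y-wide : ∀ (i j : Fin (suc n)) → Y (+ toℕ i) ≤ Y (+ toℕ j) + + suc m
  Y-wide i j = subst (Y (+ toℕ i) ≤_)
    (trans (Y-shift (+ toℕ j) 1ℤ) (cong (_+_ (Y (+ toℕ j))) (ℤ.*-identityˡ (+ suc m))))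
    (Y-mono (subst (+ toℕ i ≤_) (cong (_+_ (+ toℕ j)) (sym (ℤ.*-identityˡ (+ suc n))))
      (+≤+ (ℕ.≤-trans (ℕ.<⇒≤ (toℕ<n i)) (ℕ.m≤n+m (suc n) (toℕ j))))))

  meet-stair : Staircase (suc m) meet
  meet-stair = staircase-⊓ u-stair
    ( (λ i j i≤j → ℤ.+-monoˡ-≤ -1ℤ (Y-mono (+≤+ i≤j)))
    , (λ i j → ≤-via (Y-wide i j) (eq (Y (+ toℕ i)) (Y (+ toℕ j)) (+ suc m))))
    where
    eq : ∀ x y z → y + z - x ≡ y - 1ℤ + z - (x - 1ℤ)
    eq = solve-∀

  index : ℤ → Fin (suc n) → ℤ
  index τ σ = τ * + suc n + + toℕ σ

  Y-index : ∀ τ σ → Y (index τ σ) ≡ Y (+ toℕ σ) + τ * + suc m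
  Y-index τ σ = trans (cong Y (ℤ.+-comm (τ * + suc n) (+ toℕ σ))) (Y-shift (+ toℕ σ) τ)

  meet-dominates-Y : ∀ s → s < count (suc m) meet (Y s)
  meet-dominates-Y s with divMod n s
  ... | τ , σ , refl = below⇒index< (suc m) meet-stair σ τ (Y (index τ σ))
    (subst (meet σ + τ * + suc m <_) (sym (Y-index τ σ))
      (ℤ.+-monoˡ-< (τ * + suc m)
        (ℤ.≤-<-trans (ℤ.i⊓j≤j (u σ) (Y (+ toℕ σ) - 1ℤ)) (x-1<x (Y (+ toℕ σ))))))

  module _ (w : Fin (suc n) → ℤ) (w≤u : ∀ i → w i ≤ u i)
           (w-dominates-Y : ∀ s → s < count (suc m) w (Y s)) where

    -- Let `s` be the last index whose entry in the extension of `meet` lies below `h`. If that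
    -- minimum is attained by `u`, then `u`, and hence the smaller `w`, also counts `s` below `h`.
    -- Otherwise `Y s ≤ h`, and domination at `s` applies.
    meet-minimal : ∀ h → count (suc m) meet h ≤ count (suc m) w h
    meet-minimal h with divMod n (count (suc m) meet h - 1ℤ)
    ... | τ , σ , s≡ = -1<⇒≤ (subst (_< count (suc m) w h) (sym s≡) index<)
      where
      below : meet σ + τ * + suc m < h
      below = index<⇒below (suc m) meet-stair σ τ h
        (subst (_< count (suc m) meet h) s≡ (x-1<x (count (suc m) meet h)))
      index< : index τ σ < count (suc m) w h
      index< with ℤ.⊓-sel (u σ) (Y (+ toℕ σ) - 1ℤ)
      ... | inj₁ meet≡u = ℤ.<-≤-trans
        (below⇒index< (suc m) u-stair σ τ h
          (subst (λ x → x + τ * + suc m < h) meet≡u below))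
        (count-anti-v (suc m) h w≤u)
      ... | inj₂ meet≡Y = ℤ.<-≤-trans (w-dominates-Y (index τ σ))
        (count-monoʳ (suc m) w (subst (_≤ h) (sym (Y-index τ σ))
          (≤-via (<⇒1+≤ (subst (λ x → x + τ * + suc m < h) meet≡Y below))
                 (eq (Y (+ toℕ σ)) (τ * + suc m) h))))
        where
        eq : ∀ y t h → h - (1ℤ + (y - 1ℤ + t)) ≡ h - (y + t)
        eq = solve-∀

    -- Over a period, the smaller counting function belongs to the larger total.
    sum≤sum-meet : sum w ≤ sum meet
    sum≤sum-meet = ≤-via (sum-mono-≤ (λ (h : Fin (suc m)) → meet-minimal (+ toℕ h)))
      (sum-count-diff (suc m) meet w)

-- The Laplacian of the complete bipartite graph

module _ {m n : ℕ} where

  Δ-aa : ∀ i′ i → Δ {m} {n} (inj₁ i′) (inj₁ i) ≡ + n * χ (i′ Fin.≟ i)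
  Δ-aa i′ i =
    trans (cong (λ z → + n * χ (i′ Fin.≟ i) - z) (cong₂ _+_ (sum-zero m) (sum-zero n)))
          (ℤ.+-identityʳ (+ n * χ (i′ Fin.≟ i)))

  Δ-bb : ∀ j′ j → Δ {m} {n} (inj₂ j′) (inj₂ j) ≡ + m * χ (j′ Fin.≟ j)
  Δ-bb j′ j =
    trans (cong (λ z → + m * χ (j′ Fin.≟ j) - z) (cong₂ _+_ (sum-zero m) (sum-zero n)))
          (ℤ.+-identityʳ (+ m * χ (j′ Fin.≟ j)))

  Δ-ba : ∀ j i → Δ {m} {n} (inj₂ j) (inj₁ i) ≡ -1ℤ
  Δ-ba j i = cong₂ _-_ (ℤ.*-zeroʳ (+ m)) (cong₂ _+_ (sum-χ (λ _ → 1ℤ) i) (sum-zero n))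

  Δ-ab : ∀ i j → Δ {m} {n} (inj₁ i) (inj₂ j) ≡ -1ℤ
  Δ-ab i j = cong₂ _-_ (ℤ.*-zeroʳ (+ n)) (cong₂ _+_ (sum-zero m) (sum-χ (λ _ → 1ℤ) j))

  laplacian-a : ∀ (k : Config m n) i →
    ∑V (λ c → k c * Δ c (inj₁ i)) ≡ + n * k (inj₁ i) - ∑[ j < n ] k (inj₂ j)
  laplacian-a k i = cong₂ _+_
    (trans (sum-cong-≗ λ i′ → trans (cong (k (inj₁ i′) *_) (Δ-aa i′ i))
                                    (eq (k (inj₁ i′)) (+ n) (χ (i′ Fin.≟ i))))
           (sum-χ (λ i′ → + n * k (inj₁ i′)) i))
    (trans (sum-cong-≗ λ j → trans (cong (k (inj₂ j) *_) (Δ-ba j i)) (eq′ (k (inj₂ j))))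
           (sum-neg (k ∘ inj₂)))
    where
    eq : ∀ k n x → k * (n * x) ≡ n * k * x
    eq = solve-∀
    eq′ : ∀ k → k * -1ℤ ≡ - k
    eq′ = solve-∀

  laplacian-b : ∀ (k : Config m n) j →
    ∑V (λ c → k c * Δ c (inj₂ j)) ≡ + m * k (inj₂ j) - ∑[ i < m ] k (inj₁ i)
  laplacian-b k j = trans (cong₂ _+_
    (trans (sum-cong-≗ λ i → trans (cong (k (inj₁ i) *_) (Δ-ab i j)) (eq′ (k (inj₁ i))))
           (sum-neg (k ∘ inj₁)))
    (trans (sum-cong-≗ λ j′ → trans (cong (k (inj₂ j′) *_) (Δ-bb j′ j))
                                    (eq (k (inj₂ j′)) (+ m) (χ (j′ Fin.≟ j))))
           (sum-χ (λ j′ → + m * k (inj₂ j′)) j)))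
    (ℤ.+-comm (- sum (k ∘ inj₁)) (+ m * k (inj₂ j)))
    where
    eq : ∀ k n x → k * (n * x) ≡ n * k * x
    eq = solve-∀
    eq′ : ∀ k → k * -1ℤ ≡ - k
    eq′ = solve-∀

  neighbourSum : Config m n → Config m n
  neighbourSum k (inj₁ _) = ∑[ j < n ] k (inj₂ j)
  neighbourSum k (inj₂ _) = ∑[ i < m ] k (inj₁ i)

  neighbourSum-nonNeg : ∀ k → NonNegative k → NonNegative (neighbourSum k)
  neighbourSum-nonNeg k 0≤k (inj₁ _) = sum-nonNeg (0≤k ∘ inj₂)
  neighbourSum-nonNeg k 0≤k (inj₂ _) = sum-nonNeg (0≤k ∘ inj₁)

  laplacian : ∀ k c → ∑V (λ c′ → k c′ * Δ c′ c) ≡ graphDegree c * k c - neighbourSum k c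
  laplacian k (inj₁ i) = laplacian-a k i
  laplacian k (inj₂ j) = laplacian-b k j

-- If each b_j is toppled so that the total over the b's is - s, then each a_i
-- has to be toppled at most - ⌈ (s - w a_i) / n ⌉ times for a non-negative
-- result, and symmetrically; so only the two totals matter for effectiveness.

module _ {m n : ℕ} (w : Config (suc m) (suc n)) where

  aCount bCount : ℤ → ℤ
  aCount = count (suc n) (w ∘ inj₁)
  bCount = count (suc m) (w ∘ inj₂)

  -- For the negated totals `s` and `t` of a toppling vector reaching some `v ≥ 0`, non-negativity
  -- on the a's gives `aCount s ≤ t` and on the b's `bCount t ≤ s`, against domination at `s`.
  dominating⇒¬effective : (∀ s → s < bCount (aCount s)) → ¬ Effective w
  dominating⇒¬effective dom (v , v≥0 , k , w-v≡) = ℤ.<-irrefl refl (ℤ.<-≤-trans (dom s)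
    (ℤ.≤-trans (count-monoʳ (suc m) (w ∘ inj₂) aCount≤t) bCount≤s))
    where
    s = - sum (k ∘ inj₂)
    t = - sum (k ∘ inj₁)
    eq : ∀ w v n k S T → T ≡ - S →
         w - v ≡ n * k - S → v - 0ℤ ≡ (- k) * n - (T - w)
    eq w v n k S _ refl h =
      trans (eq₁ w v) (trans (cong (_-_ w) h) (eq₂ w n k S))
      where
      eq₁ : ∀ w v → v - 0ℤ ≡ w - (w - v)
      eq₁ = solve-∀
      eq₂ : ∀ w n k S → w - (n * k - S) ≡ (- k) * n - (- S - w)
      eq₂ = solve-∀
    aCount≤t : aCount s ≤ t
    aCount≤t = subst (aCount s ≤_) (sum-neg (k ∘ inj₁)) (sum-mono-≤ {g = λ i → - k (inj₁ i)} λ i →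
      ⌈/⌉-least (suc n) {s - w (inj₁ i)} (≤-via (v≥0 (inj₁ i))
        (eq (w (inj₁ i)) (v (inj₁ i)) (+ suc n) (k (inj₁ i)) (sum (k ∘ inj₂)) s refl
            (trans (w-v≡ (inj₁ i)) (laplacian-a k i)))))
    bCount≤s : bCount t ≤ s
    bCount≤s = subst (bCount t ≤_) (sum-neg (k ∘ inj₂)) (sum-mono-≤ {g = λ j → - k (inj₂ j)} λ j →
      ⌈/⌉-least (suc m) {t - w (inj₂ j)} (≤-via (v≥0 (inj₂ j))
        (eq (w (inj₂ j)) (v (inj₂ j)) (+ suc m) (k (inj₂ j)) (sum (k ∘ inj₁)) t refl
            (trans (w-v≡ (inj₂ j)) (laplacian-b k j)))))

  ¬effective⇒dominating : ¬ Effective w → ∀ s → s < bCount (aCount s)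
  ¬effective⇒dominating ¬eff s = ℤ.≰⇒> λ b≤s → ¬eff
    ( (λ x → w x - ∑V (λ c → k c * Δ c x))
    , nonNegative b≤s
    , k , λ x → eq (w x) (∑V (λ c → k c * Δ c x)))
    where
    t = aCount s
    k : Config (suc m) (suc n)
    -- Every vertex topples as often as the assumed total of the other side permits. The b's then
    -- total `- bCount t` instead of `- s`; by `b≤s` this gives the a's at least as much.
    k (inj₁ i) = - ⌈ (s - w (inj₁ i)) / suc n ⌉
    k (inj₂ j) = - ⌈ (t - w (inj₂ j)) / suc m ⌉
    eq : ∀ w x → w - (w - x) ≡ x
    eq = solve-∀
    eq₁ : ∀ n c s b w → c * n + s - (s - w + b) ≡ w - (n * - c - - b) - 0ℤ
    eq₁ = solve-∀
    nonNegative : bCount t ≤ s → ∀ x → 0ℤ ≤ w x - ∑V (λ c → k c * Δ c x)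
    nonNegative b≤s (inj₁ i) = subst (λ z → 0ℤ ≤ w (inj₁ i) - z)
      (sym (trans (laplacian-a k i) (cong (_-_ (+ suc n * k (inj₁ i)))
        (sum-neg (λ j → ⌈ (t - w (inj₂ j)) / suc m ⌉)))))
      (≤-via (ℤ.+-mono-≤ (x≤⌈x/d⌉*d (suc n) (s - w (inj₁ i))) b≤s)
        (eq₁ (+ suc n) ⌈ (s - w (inj₁ i)) / suc n ⌉ s (bCount t) (w (inj₁ i))))
    nonNegative b≤s (inj₂ j) = subst (λ z → 0ℤ ≤ w (inj₂ j) - z)
      (sym (trans (laplacian-b k j) (cong (_-_ (+ suc m * k (inj₂ j)))
        (sum-neg (λ i → ⌈ (s - w (inj₁ i)) / suc n ⌉)))))
      (≤-via (ℤ.+-mono-≤ (x≤⌈x/d⌉*d (suc m) (t - w (inj₂ j))) (ℤ.≤-refl {t}))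
        (eq₁ (+ suc m) ⌈ (t - w (inj₂ j)) / suc m ⌉ t t (w (inj₂ j))))

-- Toppling a single vertex other than the sink

ΔSet-singleton : ∀ {m n} (c₀ x : V m n) →
  ΔSet (λ c → does (c ≟ c₀)) x ≡ ∑V (λ c → χ (c ≟ c₀) * Δ c x)
ΔSet-singleton c₀ x = cong₂ _+_ (sum-cong-≗ (λ i → if-χ (inj₁ i))) (sum-cong-≗ (λ j → if-χ (inj₂ j)))
  where
  if-χ : ∀ c → (if does (c ≟ c₀) then Δ c x else 0ℤ) ≡ χ (c ≟ c₀) * Δ c x
  if-χ c with does (c ≟ c₀)
  ... | true  = sym (ℤ.*-identityˡ (Δ c x))
  ... | false = refl

χ-nonNeg : ∀ {P : Set} (P? : Dec P) → 0ℤ ≤ χ P?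
χ-nonNeg (yes _) = +≤+ ℕ.z≤n
χ-nonNeg (no _)  = ℤ.≤-refl

-- Toppling `c₀` alone must leave a negative vertex other than the sink. Vertices other than `c₀`
-- lose nothing, so it is `c₀`, which loses at most its degree.
parking⇒<graphDegree : ∀ {m n} {u : Config (suc m) n} → Parking u →
  ∀ c → c ≢ sink → u c < graphDegree c
parking⇒<graphDegree {m} {n} {u} (u≥0 , unstable) c₀ c₀≢sink
  with unstable (λ c → does (c ≟ c₀)) (c₀ , dec-true (c₀ ≟ c₀) refl) singleton≢sink
  where
  singleton≢sink : ∀ c → does (c ≟ c₀) ≡ true → c ≢ sink
  singleton≢sink c c∈ c≡sink = contradiction
    (trans (sym c∈) (dec-false (c ≟ c₀) λ c≡c₀ → c₀≢sink (trans (sym c≡c₀) c≡sink))) λ ()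
... | c , c≢sink , c<0 = bound (c ≟ c₀)
  (subst (λ z → u c - z < 0ℤ) (trans (ΔSet-singleton c₀ c) (laplacian k c)) c<0)
  where
  k : Config (suc m) n
  k x = χ (x ≟ c₀)
  S = neighbourSum k c
  0≤S : 0ℤ ≤ S
  0≤S = neighbourSum-nonNeg k (λ x → χ-nonNeg (x ≟ c₀)) c
  bound : (c≟c₀ : Dec (c ≡ c₀)) → u c - (graphDegree c * χ c≟c₀ - S) < 0ℤ →
    u c₀ < graphDegree c₀
  bound (yes refl) lt = <-via (ℤ.+-mono-<-≤ lt 0≤S) (eq (u c) (graphDegree c) S)
    where
    eq : ∀ x d S → 0ℤ + S - (x - (d * 1ℤ - S) + 0ℤ) ≡ d - x
    eq = solve-∀
  bound (no _) lt = contradiction lt (ℤ.≤⇒≯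
    (≤-via (ℤ.+-mono-≤ (u≥0 c c≢sink) 0≤S) (eq (u c) (graphDegree c) S)))
    where
    eq : ∀ x d S → x + S - (0ℤ + 0ℤ) ≡ x - (d * 0ℤ - S) - 0ℤ
    eq = solve-∀

-- The r-vector

-- The numerator lies strictly between `- suc n` and `suc n`, so its ceiling is 1 if it is positive
-- and 0 otherwise. These are the summands subtracted in `r`.
⌈i-a/n⌉≡χ : ∀ n a (i : Fin (suc n)) → 0ℤ ≤ a → a < + suc n →
  (a+1≤i : Dec (a + 1ℤ ≤ + toℕ i)) → ⌈ (+ toℕ i - a) / suc n ⌉ ≡ χ a+1≤i
⌈i-a/n⌉≡χ n a i 0≤a a<n (yes a+1≤i) = ⌈/⌉-unique (suc n) {+ toℕ i - a}
  (<-via (ℤ.<-≤-trans (subst (a <_) (ℤ.+-comm 1ℤ a) (ℤ.suc[i]≤j⇒i<j ℤ.≤-refl)) a+1≤i)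
         (eq₁ (+ toℕ i) a))
  (≤-via (ℤ.+-mono-≤ (+≤+ (ℕ.<⇒≤ (toℕ<n i))) 0≤a) (eq₂ (+ toℕ i) a (+ suc n)))
  where
  eq₁ : ∀ i a → i - a ≡ i - a - 0ℤ
  eq₁ = solve-∀
  eq₂ : ∀ i a n → n + a - (i + 0ℤ) ≡ 1ℤ * n - (i - a)
  eq₂ = solve-∀
⌈i-a/n⌉≡χ n a i 0≤a a<n (no a+1≰i) = ⌈/⌉-unique (suc n) {+ toℕ i - a}
  (<-via (ℤ.+-mono-<-≤ a<n (+≤+ (ℕ.z≤n {toℕ i}))) (eq₁ (+ toℕ i) a (+ suc n)))
  (≤-via (<⇒1+≤ (ℤ.≰⇒> a+1≰i)) (eq₂ (+ toℕ i) a))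
  where
  eq₁ : ∀ i a n → n + i - (a + 0ℤ) ≡ i - a - -1ℤ * n
  eq₁ = solve-∀
  eq₂ : ∀ i a → a + 1ℤ - (1ℤ + i) ≡ 0ℤ - (i - a)
  eq₂ = solve-∀

-- This is the contribution of the sink. The numerator is `1 + toℕ i - R` less `Q` periods, and
-- `1 + toℕ i - R` has ceiling 0 or 1 according to its sign.
⌈i-x/n⌉≡1-Q-χ : ∀ n Q R x (i : Fin (suc n)) → R ℕ.< suc n →
  x ≡ + suc n * + Q + + R - 1ℤ → (i<R : Dec (suc (toℕ i) ℕ.≤ R)) →
  ⌈ (+ toℕ i - x) / suc n ⌉ ≡ 1ℤ - + Q - χ i<R
⌈i-x/n⌉≡1-Q-χ n Q R _ i R<n refl (yes i<R) = ⌈/⌉-unique (suc n)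
  (<-via (ℤ.+-mono-<-≤ (+<+ R<n) (+≤+ (ℕ.z≤n {suc (toℕ i)})))
         (eq₁ (+ toℕ i) (+ suc n) (+ Q) (+ R)))
  (≤-via (+≤+ i<R) (eq₂ (+ toℕ i) (+ suc n) (+ Q) (+ R)))
  where
  eq₁ : ∀ i n Q R → n + (1ℤ + i) - (R + 0ℤ) ≡
    i - (n * Q + R - 1ℤ) - (1ℤ - Q - 1ℤ - 1ℤ) * n
  eq₁ = solve-∀
  eq₂ : ∀ i n Q R → R - (1ℤ + i) ≡ (1ℤ - Q - 1ℤ) * n - (i - (n * Q + R - 1ℤ))
  eq₂ = solve-∀
⌈i-x/n⌉≡1-Q-χ n Q R _ i R<n refl (no i≮R) = ⌈/⌉-unique (suc n)
  (<-via (+<+ (ℕ.≰⇒> i≮R)) (eq₁ (+ toℕ i) (+ suc n) (+ Q) (+ R)))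
  (≤-via (ℤ.+-mono-≤ (+≤+ (toℕ<n i)) (+≤+ (ℕ.z≤n {R})))
         (eq₂ (+ toℕ i) (+ suc n) (+ Q) (+ R)))
  where
  eq₁ : ∀ i n Q R → 1ℤ + i - R ≡ i - (n * Q + R - 1ℤ) - (1ℤ - Q - 0ℤ - 1ℤ) * n
  eq₁ = solve-∀
  eq₂ : ∀ i n Q R → n + R - (1ℤ + i + 0ℤ) ≡ (1ℤ - Q - 0ℤ) * n - (i - (n * Q + R - 1ℤ))
  eq₂ = solve-∀

0⊔p≡b-b⊓[b-p] : ∀ b p → 0ℤ ⊔ p ≡ b - (b ⊓ (b - p))
0⊔p≡b-b⊓[b-p] b p with ℤ.≤-total 0ℤ p
... | inj₁ 0≤p = trans (ℤ.i≤j⇒i⊔j≡j 0≤p) (trans (eq b p)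
  (cong (_-_ b) (sym (ℤ.i≥j⇒i⊓j≡j (≤-via 0≤p (eq′ b p))))))
  where
  eq : ∀ b p → p ≡ b - (b - p)
  eq = solve-∀
  eq′ : ∀ b p → p - 0ℤ ≡ b - (b - p)
  eq′ = solve-∀
... | inj₂ p≤0 = trans (ℤ.i≥j⇒i⊔j≡i p≤0) (trans (sym (ℤ.+-inverseʳ b))
  (cong (_-_ b) (sym (ℤ.i≤j⇒i⊓j≡i (≤-via p≤0 (eq b p))))))
  where
  eq : ∀ b p → 0ℤ - p ≡ b - p - b
  eq = solve-∀

module _ {m n : ℕ} {u : Config (suc m) (suc n)} (park : Parking u) where

  private
    0≤u = proj₁ park
    u<graphDegree = parking⇒<graphDegree park

  parking⇒staircase : Sorted u → Staircase (suc m) (u ∘ inj₂)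
  parking⇒staircase (_ , b-mono) = b-mono , λ i j → ℤ.≤-trans
    (ℤ.<⇒≤ (u<graphDegree (inj₂ i) λ ()))
    (subst (_≤ u (inj₂ j) + + suc m) (ℤ.+-identityˡ (+ suc m))
      (ℤ.+-monoˡ-≤ (+ suc m) (0≤u (inj₂ j) λ ())))

  module _ (Q R : ℕ) (R<n : R ℕ.< suc n) (u-sink : u sink + 1ℤ ≡ + suc n * + Q + + R)
           (i : Fin (suc n)) where

    aCount-value : aCount u (+ toℕ i) ≡
      (∑[ j < m ] χ (u (inj₁ (inject₁ j)) + 1ℤ ℤ.≤? + toℕ i))
        + (1ℤ - + Q - χ (suc (toℕ i) ℕ.≤? R))
    aCount-value = trans
      -- The sink is the last of the a's; splitting it off leaves exactly the sum in `r`.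
      (sum-init-last (λ j → ⌈ (+ toℕ i - u (inj₁ j)) / suc n ⌉))
      (cong₂ _+_
        (sum-cong-≗ λ j → ⌈i-a/n⌉≡χ n (u (inj₁ (inject₁ j))) i
          (0≤u (inj₁ (inject₁ j)) (inject₁≢sink j))
          (u<graphDegree (inj₁ (inject₁ j)) (inject₁≢sink j)) (_ ℤ.≤? _))
        (⌈i-x/n⌉≡1-Q-χ n Q R (u sink) i R<n
          (trans (eq (u sink)) (cong (_- 1ℤ) u-sink)) (_ ℕ.≤? _)))
      where
      eq : ∀ x → x ≡ x + 1ℤ - 1ℤ
      eq = solve-∀
      inject₁≢sink : ∀ (j : Fin m) → inj₁ (inject₁ j) ≢ sink {m} {suc n}
      inject₁≢sink j h = Fin.fromℕ≢inject₁ (sym (inj₁-injective h))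

    -- Identifies a term of the rank formula with the amount by which the optimal lowering reduces
    -- one b.
    term-value : 0ℤ ⊔ (+ Q + χ (suc (toℕ i) ℕ.≤? R) + r u i - 1ℤ) ≡
      u (inj₂ i) - (u (inj₂ i) ⊓ (aCount u (+ toℕ i) - 1ℤ))
    term-value = trans (0⊔p≡b-b⊓[b-p] (u (inj₂ i)) _)
      (cong (λ z → u (inj₂ i) - (u (inj₂ i) ⊓ z))
        (trans (eq (+ Q) (χ (suc (toℕ i) ℕ.≤? R)) (u (inj₂ i)) _)
               (cong (_- 1ℤ) (sym aCount-value))))
      where
      eq : ∀ Q χ b S → b - (Q + χ + (b + 1ℤ - S) - 1ℤ) ≡ S + (1ℤ - Q - χ) - 1ℤ
      eq = solve-∀

-- The rank

module Rank {m n : ℕ} (u : Config (suc m) (suc n)) (b-stair : Staircase (suc m) (u ∘ inj₂))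
  where

  -- Among the b-parts below u that together with the a-part of w give a
  -- non-effective configuration, meet w has the largest sum.
  module Meet (w : Config (suc m) (suc n)) =
    QuasiPeriodic m n (aCount w) (count-monoʳ (suc n) (w ∘ inj₁))
      (count-shift (suc n) (w ∘ inj₁)) (u ∘ inj₂) b-stair

  open Meet using (meet)

  optimal : Config (suc m) (suc n)
  optimal (inj₁ i) = 0ℤ
  optimal (inj₂ j) = u (inj₂ j) - meet u j

  optimal-nonNeg : NonNegative optimal
  optimal-nonNeg (inj₁ i) = ℤ.≤-refl
  optimal-nonNeg (inj₂ j) = ℤ.i≤j⇒0≤j-i (ℤ.i⊓j≤i (u (inj₂ j)) _)

  optimal-¬effective : ¬ Effective (u ⊖ optimal)
  optimal-¬effective = dominating⇒¬effective (u ⊖ optimal) λ s →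
    ℤ.<-≤-trans (Meet.meet-dominates-Y u s) (ℤ.≤-trans
      (count-monoʳ (suc m) (meet u)
        (count-anti-v (suc n) s λ i → ℤ.≤-reflexive (ℤ.+-identityʳ (u (inj₁ i)))))
      (count-anti-v (suc m) (aCount (u ⊖ optimal) s) λ j →
        ℤ.≤-reflexive (eq (u (inj₂ j)) (meet u j))))
    where
    eq : ∀ b x → b - (b - x) ≡ x
    eq = solve-∀

  degree-optimal : degree optimal ≡ ∑[ j < suc n ] (u (inj₂ j) - meet u j)
  degree-optimal = trans (cong (_+ sum bs) (sum-zero (suc m))) (ℤ.+-identityˡ (sum bs))
    where bs = optimal ∘ inj₂

  -- The b-part of `u ⊖ f` totals at most `sum (meet w)`. By Hermite's identity the a-part of `f`
  -- raises the values `aCount` over a period by its own total, and `meet` gains no more than that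
  -- over `meet u`.
  degree-minimal : ∀ f → NonNegative f → ¬ Effective (u ⊖ f) → degree optimal ≤ degree f
  degree-minimal f 0≤f ¬eff = subst (_≤ degree f)
    (sym (trans degree-optimal (∑-distrib-- (u ∘ inj₂) (meet u))))
    (≤-via (ℤ.≤-trans sum-w≤ sum-meet≤)
      (trans (cong₂ (λ x y → x - y)
               (cong (_+_ (sum (meet u))) sum-δ)
               (∑-distrib-- (u ∘ inj₂) (f ∘ inj₂)))
             (eq (sum (meet u)) (sum (f ∘ inj₁)) (sum (u ∘ inj₂)) (sum (f ∘ inj₂)))))
    where
    w = u ⊖ f
    eq : ∀ M fa b fb → M + fa - (b - fb) ≡ fa + fb - (b - M)
    eq = solve-∀
    w≤u : ∀ x → w x ≤ u x
    w≤u x = ≤-via (0≤f x) (eq′ (u x) (f x))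
      where
      eq′ : ∀ u f → f - 0ℤ ≡ u - (u - f)
      eq′ = solve-∀
    sum-w≤ : sum (w ∘ inj₂) ≤ sum (meet w)
    sum-w≤ = Meet.sum≤sum-meet w (w ∘ inj₂) (w≤u ∘ inj₂) (¬effective⇒dominating w ¬eff)
    δ : Fin (suc n) → ℤ
    δ i = aCount w (+ toℕ i) - aCount u (+ toℕ i)
    0≤δ : ∀ i → 0ℤ ≤ δ i
    0≤δ i = ℤ.i≤j⇒0≤j-i (count-anti-v (suc n) (+ toℕ i) (w≤u ∘ inj₁))
    sum-δ : sum δ ≡ sum (f ∘ inj₁)
    sum-δ = trans (∑-distrib-- {suc n} (λ i → aCount w (+ toℕ i)) (λ i → aCount u (+ toℕ i)))
      (trans (sum-count-diff (suc n) (u ∘ inj₁) (w ∘ inj₁))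
      (trans (cong (_-_ (sum (u ∘ inj₁))) (∑-distrib-- (u ∘ inj₁) (f ∘ inj₁)))
             (eq′ (sum (u ∘ inj₁)) (sum (f ∘ inj₁)))))
      where
      eq′ : ∀ a f → a - (a - f) ≡ f
      eq′ = solve-∀
    -- Raising one argument of a minimum by `δ i ≥ 0` raises the minimum by at most `δ i`.
    meet-w≤ : ∀ i → meet w i ≤ meet u i + δ i
    meet-w≤ i = subst (meet w i ≤_)
      (sym (ℤ.mono-≤-distrib-⊓ (ℤ.+-monoˡ-≤ (δ i)) (u (inj₂ i)) (aCount u (+ toℕ i) - 1ℤ)))
      (ℤ.⊓-mono-≤
        (subst (_≤ u (inj₂ i) + δ i) (ℤ.+-identityʳ (u (inj₂ i)))
          (ℤ.+-monoʳ-≤ (u (inj₂ i)) (0≤δ i)))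
        (ℤ.≤-reflexive (eq′ (aCount w (+ toℕ i)) (aCount u (+ toℕ i)))))
      where
      eq′ : ∀ x y → x - 1ℤ ≡ y - 1ℤ + (x - y)
      eq′ = solve-∀
    sum-meet≤ : sum (meet w) ≤ sum (meet u) + sum δ
    sum-meet≤ = subst (sum (meet w) ≤_) (∑-distrib-+ (meet u) δ) (sum-mono-≤ meet-w≤)

  isRank : IsRank u (-1ℤ + degree optimal)
  isRank = degree optimal
    , ( (optimal , optimal-nonNeg , optimal-¬effective , refl)
      , (λ { _ (f , 0≤f , ¬eff , refl) → degree-minimal f 0≤f ¬eff }))
    , refl

theorem11p1 : ∀ (m n : ℕ) (u : Config (suc m) (suc n)) →
    Parking u → Sorted u → 0ℤ ≤ u sink →
    (Q R : ℕ) → R ℕ.< suc n → u sink + 1ℤ ≡ + suc n * + Q + + R →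
    ∃[ ρ ] IsRank u ρ
    × ρ + 1ℤ ≡ (∑[ i < suc n ] (0ℤ ⊔ (+ Q + χ (suc (toℕ i) ℕ.≤? R) + r u i - 1ℤ)))
theorem11p1 m n u park sorted _ Q R R<n u-sink =
  -1ℤ + degree optimal , isRank ,
  trans (eq (degree optimal))
    (trans degree-optimal
           (sum-cong-≗ λ i → sym (term-value park Q R R<n u-sink i)))
  where
  open Rank u (parking⇒staircase park sorted)
  eq : ∀ d → -1ℤ + d + 1ℤ ≡ d
  eq = solve-∀
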